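{- Let $d>1$ and $f\ge0$ be integers, let $n=2d+f$, and let $\beta\in\mathcal S_n$ have cycle structure $d^2\cdot1^f$ (two $d$-cycles and $f$ fixed points). Then $(\varepsilon,\beta,\beta;(12))\in\mathrm{Par}(n)$ if and only if either <ul> <li>(i) $d$ is even and $f=0$, or</li> <li>(ii) $d$ is odd and $f\le d+1$.</li> </ul>
   Context: A Latin square of order $n$ is an $n\times n$ array with rows, columns and symbols indexed by $[n]$, each symbol occurring once in each row and each column, with triple set $O(L)$. Permutations act on the right; $\varepsilon$ is the identity. A paratopism $(\alpha,\beta,\gamma;(12))$ maps $L$ to $L^\sigma$ with triple set $\{(y\beta,x\alpha,z\gamma):(x,y,z)\in O(L)\}$; it is an autoparatopism of $L$ if $L^\sigma=L$. $\mathrm{Par}(n)$ is the set of paratopisms that are autoparatopisms of at least one Latin square of order $n$. -}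

module Defs where

open import Data.Nat using (ℕ)
open import Data.Fin using (Fin; zero; suc)
open import Data.Fin.Permutation using (Permutation′; _⟨$⟩ʳ_; _⟨$⟩ˡ_; transpose; id)
open import Data.List using (List; map; concat; length; allFin; _∷ʳ_)
open import Data.List.NonEmpty as List⁺ using (List⁺; _∷_; toList)
open import Data.List.Relation.Unary.All using (All)
open import Data.List.Relation.Binary.Permutation.Propositional using (_↭_)
open import Data.Product using (Σ; ∃; ∃!; _×_; _,_)
open import Function.Bundles using (_⇔_)
open import Relation.Binary.PropositionalEquality using (_≡_; refl)

-- Permutations act on the right: the point x β is β ⟨$⟩ʳ x.

-- The cycle (x₁ x₂ … x_k) of β, i.e. x₁β = x₂, …, x_kβ = x₁.
IsCycleOf : ∀ {n} → Permutation′ n → List⁺ (Fin n) → Set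
IsCycleOf β (x ∷ xs) = map (β ⟨$⟩ʳ_) (toList (x ∷ xs)) ≡ xs ∷ʳ x

-- Fixed points are included as cycles of length 1.
record CycleDecomposition {n : ℕ} (β : Permutation′ n) : Set where
  field
    cycles    : List (List⁺ (Fin n))
    areCycles : All (IsCycleOf β) cycles
    partition : concat (map toList cycles) ↭ allFin n

  cycleLengths : List ℕ
  cycleLengths = map List⁺.length cycles

-- The multiset of cycle lengths of β is ls.
HasCycleStructure : ∀ {n} → Permutation′ n → List ℕ → Set
HasCycleStructure β ls =
  Σ (CycleDecomposition β) λ D → CycleDecomposition.cycleLengths D ↭ ls

record LatinSquare (n : ℕ) : Set where
  field
    entry       : Fin n → Fin n → Fin n
    rowLatin    : ∀ x z → ∃! _≡_ λ y → entry x y ≡ z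
    columnLatin : ∀ y z → ∃! _≡_ λ x → entry x y ≡ z

Triple : ℕ → Set
Triple n = Fin n × Fin n × Fin n

coord : ∀ {n} → Triple n → Fin 3 → Fin n
coord (x , y , z) zero             = x
coord (x , y , z) (suc zero)       = y
coord (x , y , z) (suc (suc zero)) = z

O : ∀ {n} → LatinSquare n → Triple n → Set
O L (x , y , z) = LatinSquare.entry L x y ≡ z

record Paratopism (n : ℕ) : Set where
  constructor ⟨_,_,_⨾_⟩
  field
    α β γ : Permutation′ n
    δ     : Permutation′ 3

  component : Fin 3 → Permutation′ n
  component zero             = α
  component (suc zero)       = β
  component (suc (suc zero)) = γ

-- Apply α, β, γ to the three coordinates, then move the entry in
-- position i to position iδ.
act : ∀ {n} → Paratopism n → Triple n → Triple n
act {n} σ t = at zero , at (suc zero) , at (suc (suc zero))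
  where
  open Paratopism σ
  at : Fin 3 → Fin n
  at j = component (δ ⟨$⟩ˡ j) ⟨$⟩ʳ coord t (δ ⟨$⟩ˡ j)

-- The transposition (12), with positions 1, 2, 3 numbered from 0.
⟨12⟩ : Permutation′ 3
⟨12⟩ = transpose zero (suc zero)

act-⟨12⟩ : ∀ {n} (α β γ : Permutation′ n) x y z →
  act ⟨ α , β , γ ⨾ ⟨12⟩ ⟩ (x , y , z) ≡ (β ⟨$⟩ʳ y , α ⟨$⟩ʳ x , γ ⟨$⟩ʳ z)
act-⟨12⟩ α β γ x y z = refl

-- The triple set of L^σ.
O^ : ∀ {n} → LatinSquare n → Paratopism n → Triple n → Set
O^ L σ u = ∃ λ t → O L t × u ≡ act σ t

IsAutoparatopism : ∀ {n} → Paratopism n → LatinSquare n → Set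
IsAutoparatopism σ L = ∀ u → O^ L σ u ⇔ O L u

Par : (n : ℕ) → Paratopism n → Set
Par n σ = ∃ λ (L : LatinSquare n) → IsAutoparatopism σ L

ε : ∀ {n} → Permutation′ n
ε = id

{-# OPTIONS --safe #-}

module Submission where

open import Defs
import Algebra.Solver.Ring as RingSolver
open import Algebra.Solver.Ring.AlmostCommutativeRing using (AlmostCommutativeRing; _-Raw-AlmostCommutative⟶_; Induced-equivalence)
import Algebra.Structures.Biased as Biased
open import Data.Fin using (Fin; zero; suc; toℕ; fromℕ<; opposite; punchOut)
open import Data.Fin.Permutation using (Permutation′; _⟨$⟩ʳ_; _⟨$⟩ˡ_; inverseˡ; inverseʳ)
open import Data.Fin.Properties using (_≟_; any?; injective⇒≤; nonZeroIndex; opposite-prop; punchOut-injective; toℕ<n; toℕ-fromℕ<; toℕ-injective; +↔⊎; *↔×)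
open import Data.Integer as ℤ using (ℤ; +_; 0ℤ; 1ℤ)
import Data.Integer.DivMod as ℤ
import Data.Integer.Properties as ℤ
import Data.Integer.Solver as ℤSolver
open import Data.List using ([]; _∷_; map; length; replicate; _++_; _∷ʳ_)
open import Data.List.Membership.Propositional using (_∈_)
open import Data.List.Membership.Propositional.Properties using (∈-allFin; ∈-concat⁻′; ∈-map⁻)
open import Data.List.NonEmpty as List⁺ using (toList) renaming (_∷_ to _∷⁺_)
open import Data.List.Properties using (∷-injective)
open import Data.List.Relation.Binary.Permutation.Propositional using (↭-sym)
open import Data.List.Relation.Binary.Permutation.Propositional.Properties using (All-resp-↭; ∈-resp-↭; ↭-map-inv)
open import Data.List.Relation.Unary.All using (All; []; _∷_)
open import Data.List.Relation.Unary.Any using (here; there)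
open import Data.Maybe using (Maybe; just; nothing)
open import Data.Maybe.Properties using (just-injective; ≡-dec)
open import Data.Nat as ℕ using (ℕ; zero; suc; NonZero; _+_; _*_; _≤_; _<_; s≤s; z<s)
open import Data.Nat.Divisibility using (_∣_; divides; ∣⇒≤)
import Data.Nat.DivMod as ℕ
import Data.Nat.Properties as ℕ
open import Data.Product using (∃; _×_; _,_; proj₁; proj₂)
open import Data.Sum using (_⊎_; inj₁; inj₂)
open import Data.Sum.Function.Propositional using (_⊎-↔_)
open import Data.Sum.Properties using (inj₁-injective; inj₂-injective)
open import Function using (_∘_; _↔_; Equivalence; Inverse; mk⇔)
open import Function.Bundles using (_⇔_)
open import Function.Construct.Composition using () renaming (inverse to _∘↔_)
open import Function.Construct.Identity using (↔-id)
open import Relation.Binary.Definitions using (WeaklyDecidable)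
open import Relation.Binary.PropositionalEquality
open import Relation.Nullary using (¬_; Dec; yes; no; contradiction)
open import Relation.Nullary.Decidable using (_×-dec_)

-- Write the points as i_A, i_B (i ∈ ℤ/d) and fixed points, with β acting as i ↦ i + 1.
-- Then (ε, β, β; (12)) is an autoparatopism of L iff L(yβ, x) = L(x, y)β, whence
-- L(xβ, yβ) = L(x, y)β². If d = 2q and e is fixed, then L(e, yβ^q) = L(e, y), so there are
-- no fixed points. If d is odd, a fixed symbol occurs in row 0_A either in one of the d
-- columns j_B or in a column j_A with j = −j − 1, of which there is one; so f ≤ d + 1.
--
-- Conversely, ℤ/d × ℤ/2 settles f = 0. For d odd let 2h + 1 = 0, and call g = j − i − h the
-- gap of the cell (i, j); the paratopism sends gap g to gap −g. Let T = {−k, …, k} and give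
-- each fixed point a slot: a distinct t ∈ T, written ∞_t, and, if f = 2k + 2, one extra
-- point ∞. Starting from i + j, the cells of gap g ∈ T in the AB-block receive ∞_g, those
-- in the BA-block receive ∞_{−g}, the symbols of gap g ∈ T in the BB-block move from A to
-- B, and the cells of gap 0 in the AA- and BB-blocks receive ∞. The displaced symbols go to
-- the rows and columns of the fixed points.

-- Arithmetic modulo d on `Fin d`.

module Cyclic (d : ℕ) .{{_ : NonZero d}} where

  infixl 7 _⊗_
  infixl 6 _⊕_
  infix  8 ⊖_
  infix  4 _≋_

  ι : Fin d → ℤ
  ι x = + toℕ x

  -- Congruence modulo d with an explicit quotient, so that each compatibility law becomes a
  -- polynomial identity over the integers.
  record _≋_ (a b : ℤ) : Set where
    constructor mod
    field
      quotient : ℤ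
      equation : a ≡ b ℤ.+ quotient ℤ.* + d

  opaque

    π : ℤ → Fin d
    π a = fromℕ< (ℤ.n%ℕd<d a d)

    ι-π : ∀ a → ι (π a) ≋ a
    ι-π a = mod (ℤ.- q) (begin
      + toℕ (π a)                             ≡⟨ cong +_ (toℕ-fromℕ< _) ⟩
      + r
        ≡⟨ solve 3 (λ r q d → r := (r :+ q :* d) :+ (:- q) :* d) refl (+ r) q (+ d) ⟩
      (+ r ℤ.+ q ℤ.* + d) ℤ.+ (ℤ.- q) ℤ.* + d ≡⟨ cong (ℤ._+ (ℤ.- q) ℤ.* + d) (ℤ.a≡a%ℕn+[a/ℕn]*n a d) ⟨
      a ℤ.+ (ℤ.- q) ℤ.* + d                   ∎)
      where
      open ≡-Reasoning
      open ℤSolver.+-*-Solver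
      q : ℤ
      q = a ℤ./ℕ d
      r : ℕ
      r = a ℤ.%ℕ d

    toℕ-π : ∀ m → toℕ (π (+ m)) ≡ m ℕ.% d
    toℕ-π m = toℕ-fromℕ< _

  -- The difference r - s is a multiple of d whose absolute value is at most max(r, s) < d, hence it
  -- is 0.
  residue-unique : ∀ {r s} → r ℕ.< d → s ℕ.< d → + r ≋ + s → r ≡ s
  residue-unique {r} {s} r<d s<d (mod k eq) = ℤ.+-injective (ℤ.i-j≡0⇒i≡j (+ r) (+ s) (ℤ.∣i∣≡0⇒i≡0 ∣r-s∣≡0))
    where
    r-s≡kd : + r ℤ.- + s ≡ k ℤ.* + d
    r-s≡kd = trans (cong (ℤ._- + s) eq)
      (solve 2 (λ s t → s :+ t :- s := t) refl (+ s) (k ℤ.* + d))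
      where open ℤSolver.+-*-Solver
    d∣ : d ∣ ℤ.∣ + r ℤ.- + s ∣
    d∣ = divides ℤ.∣ k ∣ (trans (cong ℤ.∣_∣ r-s≡kd) (ℤ.abs-* k (+ d)))
    small : ℤ.∣ + r ℤ.- + s ∣ ℕ.< d
    small = ℕ.≤-<-trans
      (subst (ℕ._≤ r ℕ.⊔ s) (cong ℤ.∣_∣ (sym (ℤ.[+m]-[+n]≡m⊖n r s))) (ℤ.∣m⊝n∣≤m⊔n r s))
      (ℕ.⊔-lub r<d s<d)
    ∣r-s∣≡0 : ℤ.∣ + r ℤ.- + s ∣ ≡ 0
    ∣r-s∣≡0 with ℤ.∣ + r ℤ.- + s ∣ | d∣ | small
    ... | zero  | _  | _ = refl
    ... | suc m | dv | m<d with () ← ℕ.<⇒≱ m<d (∣⇒≤ dv)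

  ≋-sym : ∀ {a b} → a ≋ b → b ≋ a
  ≋-sym {a} {b} (mod k refl) = mod (ℤ.- k)
    (solve 3 (λ b k d → b := (b :+ k :* d) :+ (:- k) :* d) refl b k (+ d))
    where open ℤSolver.+-*-Solver

  ≋-trans : ∀ {a b c} → a ≋ b → b ≋ c → a ≋ c
  ≋-trans {c = c} (mod k refl) (mod l refl) = mod (l ℤ.+ k)
    (solve 4 (λ c k l d → (c :+ l :* d) :+ k :* d := c :+ (l :+ k) :* d) refl c k l (+ d))
    where open ℤSolver.+-*-Solver

  ≋-+ : ∀ {a b a′ b′} → a ≋ a′ → b ≋ b′ → (a ℤ.+ b) ≋ (a′ ℤ.+ b′)
  ≋-+ {a′ = a} {b} (mod k refl) (mod l refl) = mod (k ℤ.+ l)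
    (solve 5 (λ a b k l d → (a :+ k :* d) :+ (b :+ l :* d) := a :+ b :+ (k :+ l) :* d)
      refl a b k l (+ d))
    where open ℤSolver.+-*-Solver

  ≋-* : ∀ {a b a′ b′} → a ≋ a′ → b ≋ b′ → (a ℤ.* b) ≋ (a′ ℤ.* b′)
  ≋-* {a′ = a} {b} (mod k refl) (mod l refl) = mod (a ℤ.* l ℤ.+ k ℤ.* b ℤ.+ k ℤ.* l ℤ.* + d)
    (solve 5 (λ a b k l d → (a :+ k :* d) :* (b :+ l :* d)
                        := a :* b :+ (a :* l :+ k :* b :+ k :* l :* d) :* d)
      refl a b k l (+ d))
    where open ℤSolver.+-*-Solver

  ≋-neg : ∀ {a a′} → a ≋ a′ → (ℤ.- a) ≋ (ℤ.- a′)
  ≋-neg {a′ = a} (mod k refl) = mod (ℤ.- k)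
    (solve 3 (λ a k d → :- (a :+ k :* d) := :- a :+ (:- k) :* d) refl a k (+ d))
    where open ℤSolver.+-*-Solver

  π-cong : ∀ {a b} → a ≋ b → π a ≡ π b
  π-cong {a} {b} a≋b = toℕ-injective (residue-unique (toℕ<n (π a)) (toℕ<n (π b))
    (≋-trans (ι-π a) (≋-trans a≋b (≋-sym (ι-π b)))))

  π-ι : ∀ x → π (ι x) ≡ x
  π-ι x = toℕ-injective (residue-unique (toℕ<n (π (ι x))) (toℕ<n x) (ι-π (ι x)))

  toℕ-π-< : ∀ {m} → m ℕ.< d → toℕ (π (+ m)) ≡ m
  toℕ-π-< m<d = trans (toℕ-π _) (ℕ.m<n⇒m%n≡m m<d)

  π-period : π (+ d) ≡ π 0ℤ
  π-period = π-cong {b = 0ℤ} (mod 1ℤ (solve 1 (λ d → d := con 0ℤ :+ con 1ℤ :* d) refl (+ d)))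
    where open ℤSolver.+-*-Solver

  opaque

    _⊕_ _⊗_ : Fin d → Fin d → Fin d
    x ⊕ y = π (ι x ℤ.+ ι y)
    x ⊗ y = π (ι x ℤ.* ι y)

    ⊖_ : Fin d → Fin d
    ⊖ x = π (ℤ.- ι x)

    π-+ : ∀ a b → π (a ℤ.+ b) ≡ π a ⊕ π b
    π-+ a b = sym (π-cong (≋-+ (ι-π a) (ι-π b)))

    π-* : ∀ a b → π (a ℤ.* b) ≡ π a ⊗ π b
    π-* a b = sym (π-cong (≋-* (ι-π a) (ι-π b)))

    π-neg : ∀ a → π (ℤ.- a) ≡ ⊖ π a
    π-neg a = sym (π-cong (≋-neg (ι-π a)))

    ⊕-comm : ∀ x y → x ⊕ y ≡ y ⊕ x
    ⊕-comm x y = cong π (ℤ.+-comm (ι x) (ι y))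

    ⊗-comm : ∀ x y → x ⊗ y ≡ y ⊗ x
    ⊗-comm x y = cong π (ℤ.*-comm (ι x) (ι y))

  𝟘 𝟙 : Fin d
  𝟘 = π 0ℤ
  𝟙 = π 1ℤ

  private
    -- Surjectivity of `π`: every ring law below is carried over from the integers by choosing
    -- representatives.
    rep : ∀ x → ∃ λ a → π a ≡ x
    rep x = ι x , π-ι x

    +-assoc : ∀ x y z → (x ⊕ y) ⊕ z ≡ x ⊕ (y ⊕ z)
    +-assoc x y z with a , refl ← rep x | b , refl ← rep y | c , refl ← rep z = begin
      (π a ⊕ π b) ⊕ π c     ≡⟨ cong (_⊕ π c) (π-+ a b) ⟨
      π (a ℤ.+ b) ⊕ π c     ≡⟨ π-+ (a ℤ.+ b) c ⟨
      π (a ℤ.+ b ℤ.+ c)     ≡⟨ cong π (ℤ.+-assoc a b c) ⟩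
      π (a ℤ.+ (b ℤ.+ c))   ≡⟨ π-+ a (b ℤ.+ c) ⟩
      π a ⊕ π (b ℤ.+ c)     ≡⟨ cong (π a ⊕_) (π-+ b c) ⟩
      π a ⊕ (π b ⊕ π c)     ∎
      where open ≡-Reasoning

    *-assoc : ∀ x y z → (x ⊗ y) ⊗ z ≡ x ⊗ (y ⊗ z)
    *-assoc x y z with a , refl ← rep x | b , refl ← rep y | c , refl ← rep z = begin
      (π a ⊗ π b) ⊗ π c     ≡⟨ cong (_⊗ π c) (π-* a b) ⟨
      π (a ℤ.* b) ⊗ π c     ≡⟨ π-* (a ℤ.* b) c ⟨
      π (a ℤ.* b ℤ.* c)     ≡⟨ cong π (ℤ.*-assoc a b c) ⟩
      π (a ℤ.* (b ℤ.* c))   ≡⟨ π-* a (b ℤ.* c) ⟩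
      π a ⊗ π (b ℤ.* c)     ≡⟨ cong (π a ⊗_) (π-* b c) ⟩
      π a ⊗ (π b ⊗ π c)     ∎
      where open ≡-Reasoning

    +-identityˡ : ∀ x → 𝟘 ⊕ x ≡ x
    +-identityˡ x with a , refl ← rep x = trans (sym (π-+ 0ℤ a)) (cong π (ℤ.+-identityˡ a))

    *-identityˡ : ∀ x → 𝟙 ⊗ x ≡ x
    *-identityˡ x with a , refl ← rep x = trans (sym (π-* 1ℤ a)) (cong π (ℤ.*-identityˡ a))

    *-zeroˡ : ∀ x → 𝟘 ⊗ x ≡ 𝟘
    *-zeroˡ x with a , refl ← rep x = sym (π-* 0ℤ a)

    *-distribʳ : ∀ x y z → (y ⊕ z) ⊗ x ≡ y ⊗ x ⊕ z ⊗ x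
    *-distribʳ x y z with a , refl ← rep x | b , refl ← rep y | c , refl ← rep z = begin
      (π b ⊕ π c) ⊗ π a           ≡⟨ cong (_⊗ π a) (π-+ b c) ⟨
      π (b ℤ.+ c) ⊗ π a           ≡⟨ π-* (b ℤ.+ c) a ⟨
      π ((b ℤ.+ c) ℤ.* a)         ≡⟨ cong π (ℤ.*-distribʳ-+ a b c) ⟩
      π (b ℤ.* a ℤ.+ c ℤ.* a)     ≡⟨ π-+ (b ℤ.* a) (c ℤ.* a) ⟩
      π (b ℤ.* a) ⊕ π (c ℤ.* a)   ≡⟨ cong₂ _⊕_ (π-* b a) (π-* c a) ⟩
      π b ⊗ π a ⊕ π c ⊗ π a       ∎
      where open ≡-Reasoning

    neg-*-distribˡ : ∀ x y → (⊖ x) ⊗ y ≡ ⊖ (x ⊗ y)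
    neg-*-distribˡ x y with a , refl ← rep x | b , refl ← rep y = begin
      (⊖ π a) ⊗ π b         ≡⟨ cong (_⊗ π b) (π-neg a) ⟨
      π (ℤ.- a) ⊗ π b       ≡⟨ π-* (ℤ.- a) b ⟨
      π (ℤ.- a ℤ.* b)       ≡⟨ cong π (ℤ.neg-distribˡ-* a b) ⟨
      π (ℤ.- (a ℤ.* b))     ≡⟨ π-neg (a ℤ.* b) ⟩
      ⊖ π (a ℤ.* b)         ≡⟨ cong ⊖_ (π-* a b) ⟩
      ⊖ (π a ⊗ π b)         ∎
      where open ≡-Reasoning

    neg-+-comm : ∀ x y → (⊖ x) ⊕ (⊖ y) ≡ ⊖ (x ⊕ y)
    neg-+-comm x y with a , refl ← rep x | b , refl ← rep y = begin
      (⊖ π a) ⊕ (⊖ π b)           ≡⟨ cong₂ _⊕_ (π-neg a) (π-neg b) ⟨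
      π (ℤ.- a) ⊕ π (ℤ.- b)       ≡⟨ π-+ (ℤ.- a) (ℤ.- b) ⟨
      π (ℤ.- a ℤ.+ ℤ.- b)         ≡⟨ cong π (ℤ.neg-distrib-+ a b) ⟨
      π (ℤ.- (a ℤ.+ b))           ≡⟨ π-neg (a ℤ.+ b) ⟩
      ⊖ π (a ℤ.+ b)               ≡⟨ cong ⊖_ (π-+ a b) ⟩
      ⊖ (π a ⊕ π b)               ∎
      where open ≡-Reasoning

    open Biased (_≡_ {A = Fin d})

    ring : AlmostCommutativeRing _ _
    ring = record
      { _≈_ = _≡_
      ; _+_ = _⊕_
      ; _*_ = _⊗_
      ; -_  = ⊖_
      ; 0#  = 𝟘
      ; 1#  = 𝟙
      ; isAlmostCommutativeRing = record
        { isCommutativeSemiring = IsCommutativeSemiringˡ.isCommutativeSemiring record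
          { +-isCommutativeMonoid = IsCommutativeMonoidˡ.isCommutativeMonoid record
            { isSemigroup = record
              { isMagma = record { isEquivalence = isEquivalence ; ∙-cong = cong₂ _⊕_ }
              ; assoc   = +-assoc }
            ; identityˡ = +-identityˡ
            ; comm      = ⊕-comm }
          ; *-isCommutativeMonoid = IsCommutativeMonoidˡ.isCommutativeMonoid record
            { isSemigroup = record
              { isMagma = record { isEquivalence = isEquivalence ; ∙-cong = cong₂ _⊗_ }
              ; assoc   = *-assoc }
            ; identityˡ = *-identityˡ
            ; comm      = ⊗-comm }
          ; distribʳ = *-distribʳ
          ; zeroˡ    = *-zeroˡ }
        ; -‿cong       = cong ⊖_
        ; -‿*-distribˡ = neg-*-distribˡ
        ; -‿+-comm     = neg-+-comm
        }
      }

    -- Lets `solve` use integer constants, so that `con 1ℤ` stands for `𝟙` whatever d is.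
    morphism : ℤ.+-*-rawRing -Raw-AlmostCommutative⟶ ring
    morphism = record
      { ⟦_⟧    = π
      ; +-homo = π-+
      ; *-homo = π-*
      ; -‿homo = π-neg
      ; 0-homo = refl
      ; 1-homo = refl
      }

    coeff≟ : WeaklyDecidable (Induced-equivalence morphism)
    coeff≟ a b with a ℤ.≟ b
    ... | yes a≡b = just (cong π a≡b)
    ... | no  _   = nothing

  open RingSolver ℤ.+-*-rawRing ring morphism coeff≟ public
    using (solve; _:=_; _:+_; _:*_; _:-_; :-_; con)

-- Points, rotation and twisted squares.

Point : ℕ → ℕ → Set
Point d f = (Fin 2 × Fin d) ⊎ Fin f

pattern cyc P i = inj₁ (P , i)
pattern fix e   = inj₂ e
pattern A = zero
pattern B = suc zero

other : Fin 2 → Fin 2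
other A = B
other B = A

turn : ∀ {d f} .{{_ : NonZero d}} → Fin d → Point d f → Point d f
turn {d} g (cyc P i) = cyc P (Cyclic._⊕_ d i g)
turn     g (fix e)   = fix e

rot : ∀ {d f} .{{_ : NonZero d}} → Point d f → Point d f
rot {d} = turn (Cyclic.𝟙 d)

-- Only rows are required to be Latin: the twist carries rows to columns.
record TwistedSquare (d f : ℕ) .{{_ : NonZero d}} : Set where
  field
    _∙_     : Point d f → Point d f → Point d f
    twisted : ∀ x y → rot y ∙ x ≡ rot (x ∙ y)
    divide  : ∀ x z → ∃ λ y → x ∙ y ≡ z

-- The square without fixed points.

module _ (d : ℕ) .{{_ : NonZero d}} where

  open Cyclic d

  private

    slide : ∀ i j → j ⊕ 𝟙 ⊕ i ≡ i ⊕ j ⊕ 𝟙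
    slide = solve 2 (λ i j → j :+ con 1ℤ :+ i := i :+ j :+ con 1ℤ) refl

    cancel : ∀ i m → i ⊕ (m ⊕ ⊖ i) ≡ m
    cancel = solve 2 (λ i m → i :+ (m :- i) := m) refl

  -- The addition table of ℤ/d × ℤ/2, where `rot` is translation by (1, 0). The twist holds because
  -- the group is abelian.
  groupSquare : TwistedSquare d 0
  groupSquare = record { _∙_ = _∙_ ; twisted = twisted ; divide = divide }
    where
    _∙_ : Point d 0 → Point d 0 → Point d 0
    cyc A i ∙ cyc Q j = cyc Q (i ⊕ j)
    cyc B i ∙ cyc Q j = cyc (other Q) (i ⊕ j)

    twisted : ∀ x y → rot y ∙ x ≡ rot (x ∙ y)
    twisted (cyc A i) (cyc A j) = cong (λ k → cyc A k) (slide i j)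
    twisted (cyc A i) (cyc B j) = cong (λ k → cyc B k) (slide i j)
    twisted (cyc B i) (cyc A j) = cong (λ k → cyc B k) (slide i j)
    twisted (cyc B i) (cyc B j) = cong (λ k → cyc A k) (slide i j)

    divide : ∀ x z → ∃ λ y → x ∙ y ≡ z
    divide (cyc A i) (cyc R m) = cyc R (m ⊕ ⊖ i) , cong (λ k → cyc R k) (cancel i m)
    divide (cyc B i) (cyc A m) = cyc B (m ⊕ ⊖ i) , cong (λ k → cyc A k) (cancel i m)
    divide (cyc B i) (cyc B m) = cyc A (m ⊕ ⊖ i) , cong (λ k → cyc B k) (cancel i m)

  -- just t is the slot of the point ∞_t, and nothing that of the extra point ∞. The symbols
  -- displaced by ∞ in the AA- and BB-blocks must lie in different cycles, so 0 has to be in T.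
  record Slots (f : ℕ) : Set where
    field
      slot           : Fin f → Maybe (Fin d)
      slot-injective : ∀ {e e′} → slot e ≡ slot e′ → e ≡ e′
      slot-symmetric : ∀ {g} → (∃ λ e → slot e ≡ just g) → ∃ λ e → slot e ≡ just (⊖ g)
      slot-zero      : (∃ λ e → slot e ≡ nothing) → ∃ λ e → slot e ≡ just 𝟘

  -- Prolongation of the table of i + j by fixed points, for d odd.

  module Prolongation {f : ℕ} (h : Fin d) (2h+1≡0 : h ⊕ h ⊕ 𝟙 ≡ 𝟘) (slots : Slots f) where

    open Slots slots

    fill : {P : Fin f → Set} → Dec (∃ P) → Point d f → Point d f
    fill (yes (e , _)) _ = fix e
    fill (no _)        p = p

    -- Which fixed point claims a cell: `OffDiagonal` serves the AB- and BA-blocks, `OnDiagonal` the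
    -- AA- and BB-blocks, where only the extra point enters.
    OffDiagonal OnDiagonal : Fin d → Fin f → Set
    OffDiagonal g e = slot e ≡ just g
    OnDiagonal  g e = g ≡ 𝟘 × slot e ≡ nothing

    off? : ∀ g → Dec (∃ (OffDiagonal g))
    off? g = any? λ e → ≡-dec _≟_ (slot e) (just g)

    on? : ∀ g → Dec (∃ (OnDiagonal g))
    on? g = any? λ e → (g ≟ 𝟘) ×-dec ≡-dec _≟_ (slot e) nothing

    -- The cycle of the symbols in the BB-block. For a gap in T the B-symbol was displaced from the
    -- BA-block, and here it returns to the row.
    layer : ∀ {g} → Dec (∃ (OffDiagonal g)) → Fin 2
    layer (yes _) = B
    layer (no _)  = A

    gap : Fin d → Fin d → Fin d
    gap i j = j ⊕ ⊖ i ⊕ ⊖ h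

    infixl 7 _∙_

    _∙_ : Point d f → Point d f → Point d f
    -- This clause precedes the split on P so that it computes for a variable P.
    cyc P i ∙ fix e with slot e
    -- The column (i + h + t)_B has gap t; the symbol lost there is (2i + h + t)_B in row i_A and
    -- (2i + h + t)_A in row i_B.
    ... | just t  = cyc (other P) (i ⊕ i ⊕ h ⊕ t)
    ... | nothing = cyc P (i ⊕ i ⊕ h)
    cyc A i ∙ cyc A j = fill (on? (gap i j)) (cyc A (i ⊕ j))
    cyc A i ∙ cyc B j = fill (off? (gap i j)) (cyc B (i ⊕ j))
    cyc B i ∙ cyc A j = fill (off? (⊖ gap i j)) (cyc B (i ⊕ j))
    cyc B i ∙ cyc B j = fill (on? (gap i j)) (cyc (layer (off? (gap i j))) (i ⊕ j))
    fix e ∙ cyc P j with slot e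
    -- Forced by the twist from the columns of fixed points: 2(j + 1) + h + t - 1 = 2j - h + t, as
    -- 2h + 1 = 0.
    ... | just t  = cyc (other P) (j ⊕ j ⊕ ⊖ h ⊕ t)
    ... | nothing = cyc P (j ⊕ j ⊕ ⊖ h)
    -- The fixed points form a subsquare, the addition table of ℤ/f; the index `e` shows that f is
    -- nonzero.
    fix e ∙ fix e′ = fix (Cyclic._⊕_ f {{nonZeroIndex e}} e e′)

    private

      cycle-cong : ∀ {P i j} → i ≡ j → _≡_ {A = Point d f} (cyc P i) (cyc P j)
      cycle-cong = cong (λ k → cyc _ k)

      off-unique : ∀ {g e e′} → OffDiagonal g e → OffDiagonal g e′ → e ≡ e′
      off-unique p q = slot-injective (trans p (sym q))

      on-unique : ∀ {g e e′} → OnDiagonal g e → OnDiagonal g e′ → e ≡ e′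
      on-unique (_ , p) (_ , q) = slot-injective (trans p (sym q))

      -- The decision procedure may find a witness other than the given one; uniqueness identifies
      -- the two.
      fill-yes : ∀ {P : Fin f → Set} {e} (P? : Dec (∃ P)) p →
        (∀ {e e′} → P e → P e′ → e ≡ e′) → P e → fill P? p ≡ fix e
      fill-yes (yes (_ , q)) p unique q′ = cong (λ e → fix e) (unique q q′)
      fill-yes (no ¬q)       p unique q′ = contradiction (_ , q′) ¬q

      fill-no : ∀ {P : Fin f → Set} (P? : Dec (∃ P)) {p} → ¬ ∃ P → fill P? p ≡ p
      fill-no (yes q) ¬q = contradiction q ¬q
      fill-no (no _)  _  = refl

      layer-yes : ∀ {g} → ∃ (OffDiagonal g) → layer (off? g) ≡ B
      layer-yes {g} q with off? g
      ... | yes _ = refl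
      ... | no ¬q = contradiction q ¬q

      layer-no : ∀ {g} → ¬ ∃ (OffDiagonal g) → layer (off? g) ≡ A
      layer-no {g} ¬q with off? g
      ... | yes q = contradiction q ¬q
      ... | no _  = refl

      neg-neg : ∀ g → ⊖ ⊖ g ≡ g
      neg-neg = solve 1 (λ g → :- (:- g) := g) refl

      neg-zero : ∀ {g} → g ≡ 𝟘 → ⊖ g ≡ 𝟘
      neg-zero refl = solve 0 (:- con 0ℤ := con 0ℤ) refl

      off-neg : ∀ {g} → ∃ (OffDiagonal (⊖ g)) → ∃ (OffDiagonal g)
      off-neg {g} = subst (λ k → ∃ (OffDiagonal k)) (neg-neg g) ∘ slot-symmetric

      layer-neg : ∀ g → layer (off? (⊖ g)) ≡ layer (off? g)
      layer-neg g with off? g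
      ... | yes q = layer-yes (slot-symmetric q)
      ... | no ¬q = layer-no (¬q ∘ off-neg)

      fill-on-neg : ∀ g p → fill (on? (⊖ g)) p ≡ fill (on? g) p
      fill-on-neg g p with on? g
      ... | yes (e , g≡0 , s) = fill-yes (on? (⊖ g)) p on-unique (neg-zero g≡0 , s)
      ... | no ¬q             = fill-no (on? (⊖ g)) λ (e , -g≡0 , s) →
        ¬q (e , trans (sym (neg-neg g)) (neg-zero -g≡0) , s)

      rot-fill : ∀ {P : Fin f → Set} (P? : Dec (∃ P)) p → fill P? (rot p) ≡ rot (fill P? p)
      rot-fill (yes _) p = refl
      rot-fill (no _)  p = refl

      -- Makes identities that rest on 2h + 1 = 0 accessible to `solve`: they are proved with an
      -- explicit multiple of 2h + 1, which then vanishes.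
      modulo : ∀ {x y} k → x ≡ y ⊕ k ⊗ (h ⊕ h ⊕ 𝟙) → x ≡ y
      modulo {x} {y} k eq = begin
        x                         ≡⟨ eq ⟩
        y ⊕ k ⊗ (h ⊕ h ⊕ 𝟙)       ≡⟨ cong (λ z → y ⊕ k ⊗ z) 2h+1≡0 ⟩
        y ⊕ k ⊗ 𝟘                 ≡⟨ solve 2 (λ y k → y :+ k :* con 0ℤ := y) refl y k ⟩
        y                         ∎
        where open ≡-Reasoning

      -- The reason for the shift by h in `gap`: i - (j + 1) - h differs from -(j - i - h) by -(2h +
      -- 1) = 0.
      gap-slide : ∀ i j → gap (j ⊕ 𝟙) i ≡ ⊖ gap i j
      gap-slide i j = modulo (⊖ 𝟙) (solve 3 (λ i j h →
        i :- (j :+ con 1ℤ) :- h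
          := :- (j :- i :- h) :+ (:- con 1ℤ) :* (h :+ h :+ con 1ℤ)) refl i j h)

      -- Matches the row of a fixed point with its column under the twist: -h = h + 1.
      row-slide : ∀ i → i ⊕ i ⊕ ⊖ h ≡ i ⊕ i ⊕ h ⊕ 𝟙
      row-slide i = modulo (⊖ 𝟙) (solve 2 (λ i h →
        i :+ i :- h
          := i :+ i :+ h :+ con 1ℤ :+ (:- con 1ℤ) :* (h :+ h :+ con 1ℤ)) refl i h)

      row-slide-just : ∀ i t → i ⊕ i ⊕ ⊖ h ⊕ t ≡ i ⊕ i ⊕ h ⊕ t ⊕ 𝟙
      row-slide-just i t = modulo (⊖ 𝟙) (solve 3 (λ i h t →
        i :+ i :- h :+ t
          := i :+ i :+ h :+ t :+ con 1ℤ :+ (:- con 1ℤ) :* (h :+ h :+ con 1ℤ)) refl i h t)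

      column-slide : ∀ j → (j ⊕ 𝟙) ⊕ (j ⊕ 𝟙) ⊕ h ≡ j ⊕ j ⊕ ⊖ h ⊕ 𝟙
      column-slide j = modulo 𝟙 (solve 2 (λ j h →
        (j :+ con 1ℤ) :+ (j :+ con 1ℤ) :+ h
          := j :+ j :- h :+ con 1ℤ :+ con 1ℤ :* (h :+ h :+ con 1ℤ)) refl j h)

      column-slide-just : ∀ j t → (j ⊕ 𝟙) ⊕ (j ⊕ 𝟙) ⊕ h ⊕ t ≡ j ⊕ j ⊕ ⊖ h ⊕ t ⊕ 𝟙
      column-slide-just j t = modulo 𝟙 (solve 3 (λ j h t →
        (j :+ con 1ℤ) :+ (j :+ con 1ℤ) :+ h :+ t
          := j :+ j :- h :+ t :+ con 1ℤ :+ con 1ℤ :* (h :+ h :+ con 1ℤ)) refl j h t)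

    twisted : ∀ x y → rot y ∙ x ≡ rot (x ∙ y)
    twisted (cyc A i) (cyc A j) = begin
      fill (on? (gap (j ⊕ 𝟙) i)) (cyc A (j ⊕ 𝟙 ⊕ i))
        ≡⟨ cong₂ (λ g k → fill (on? g) (cyc A k)) (gap-slide i j) (slide i j) ⟩
      fill (on? (⊖ gap i j)) (cyc A (i ⊕ j ⊕ 𝟙))
        ≡⟨ fill-on-neg (gap i j) (cyc A (i ⊕ j ⊕ 𝟙)) ⟩
      fill (on? (gap i j)) (cyc A (i ⊕ j ⊕ 𝟙))
        ≡⟨ rot-fill (on? (gap i j)) (cyc A (i ⊕ j)) ⟩
      rot (fill (on? (gap i j)) (cyc A (i ⊕ j)))
        ∎
      where open ≡-Reasoning
    -- The image cell lies in the BA-block with negated gap, and the sign in that block's rule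
    -- restores the slot.
    twisted (cyc A i) (cyc B j) = begin
      fill (off? (⊖ gap (j ⊕ 𝟙) i)) (cyc B (j ⊕ 𝟙 ⊕ i))
        ≡⟨ cong₂ (λ g k → fill (off? g) (cyc B k))
             (trans (cong ⊖_ (gap-slide i j)) (neg-neg (gap i j))) (slide i j) ⟩
      fill (off? (gap i j)) (cyc B (i ⊕ j ⊕ 𝟙))
        ≡⟨ rot-fill (off? (gap i j)) (cyc B (i ⊕ j)) ⟩
      rot (fill (off? (gap i j)) (cyc B (i ⊕ j)))
        ∎
      where open ≡-Reasoning
    twisted (cyc B i) (cyc A j) = begin
      fill (off? (gap (j ⊕ 𝟙) i)) (cyc B (j ⊕ 𝟙 ⊕ i))
        ≡⟨ cong₂ (λ g k → fill (off? g) (cyc B k)) (gap-slide i j) (slide i j) ⟩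
      fill (off? (⊖ gap i j)) (cyc B (i ⊕ j ⊕ 𝟙))
        ≡⟨ rot-fill (off? (⊖ gap i j)) (cyc B (i ⊕ j)) ⟩
      rot (fill (off? (⊖ gap i j)) (cyc B (i ⊕ j)))
        ∎
      where open ≡-Reasoning
    -- Neither the extra point nor the layer depends on the sign of the gap, since -0 = 0 and T =
    -- -T.
    twisted (cyc B i) (cyc B j) = begin
      fill (on? (gap (j ⊕ 𝟙) i)) (cyc (layer (off? (gap (j ⊕ 𝟙) i))) (j ⊕ 𝟙 ⊕ i))
        ≡⟨ cong₂ (λ g k → fill (on? g) (cyc (layer (off? g)) k)) (gap-slide i j) (slide i j) ⟩
      fill (on? (⊖ gap i j)) (cyc (layer (off? (⊖ gap i j))) (i ⊕ j ⊕ 𝟙))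
        ≡⟨ cong (λ P → fill (on? (⊖ gap i j)) (cyc P (i ⊕ j ⊕ 𝟙))) (layer-neg (gap i j)) ⟩
      fill (on? (⊖ gap i j)) (cyc (layer (off? (gap i j))) (i ⊕ j ⊕ 𝟙))
        ≡⟨ fill-on-neg (gap i j) (cyc (layer (off? (gap i j))) (i ⊕ j ⊕ 𝟙)) ⟩
      fill (on? (gap i j)) (cyc (layer (off? (gap i j))) (i ⊕ j ⊕ 𝟙))
        ≡⟨ rot-fill (on? (gap i j)) (cyc (layer (off? (gap i j))) (i ⊕ j)) ⟩
      rot (fill (on? (gap i j)) (cyc (layer (off? (gap i j))) (i ⊕ j)))
        ∎
      where open ≡-Reasoning
    twisted (cyc P i) (fix e) with slot e
    ... | just t  = cycle-cong (row-slide-just i t)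
    ... | nothing = cycle-cong (row-slide i)
    twisted (fix e) (cyc P j) with slot e
    ... | just t  = cycle-cong (column-slide-just j t)
    ... | nothing = cycle-cong (column-slide j)
    twisted (fix e) (fix e′) = cong (λ k → fix k)
      (F.solve 2 (λ e e′ → e′ F.:+ e F.:= e F.:+ e′) refl e e′)
      where module F = Cyclic f {{nonZeroIndex e}}

    private

      cell-just : ∀ {e t} P i → slot e ≡ just t → cyc P i ∙ fix e ≡ cyc (other P) (i ⊕ i ⊕ h ⊕ t)
      cell-just P i eq rewrite eq = refl

      cell-nothing : ∀ {e} P i → slot e ≡ nothing → cyc P i ∙ fix e ≡ cyc P (i ⊕ i ⊕ h)
      cell-nothing P i eq rewrite eq = refl

      -- In row i the symbol m belongs to column m - i. If a fixed point of slot g displaces it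
      -- there, the formula 2i + h + g for the column of that point recovers m.
      off-symbol : ∀ i m → i ⊕ i ⊕ h ⊕ gap i (m ⊕ ⊖ i) ≡ m
      off-symbol i m = solve 3 (λ i m h → i :+ i :+ h :+ (m :- i :- i :- h) := m) refl i m h

      on-symbol : ∀ i m → gap i (m ⊕ ⊖ i) ≡ 𝟘 → i ⊕ i ⊕ h ≡ m
      on-symbol i m eq = begin
        i ⊕ i ⊕ h                     ≡⟨ solve 2 (λ i h → i :+ i :+ h := i :+ i :+ h :+ con 0ℤ) refl i h ⟩
        i ⊕ i ⊕ h ⊕ 𝟘                 ≡⟨ cong (i ⊕ i ⊕ h ⊕_) eq ⟨
        i ⊕ i ⊕ h ⊕ gap i (m ⊕ ⊖ i)   ≡⟨ off-symbol i m ⟩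
        m                             ∎
        where open ≡-Reasoning

      gap-solve : ∀ i t → gap i (i ⊕ h ⊕ t) ≡ t
      gap-solve i t = solve 3 (λ i h t → i :+ h :+ t :- i :- h := t) refl i h t

      gap-zero : ∀ i → gap i (i ⊕ h) ≡ 𝟘
      gap-zero i = solve 2 (λ i h → i :+ h :- i :- h := con 0ℤ) refl i h

      -- Since 2h = -1, the residue -h is the inverse of 2.
      halve : ∀ c → (⊖ h ⊗ c) ⊕ (⊖ h ⊗ c) ≡ c
      halve c = modulo (⊖ c) (solve 2 (λ h c →
        (:- h :* c) :+ (:- h :* c) := c :+ (:- c) :* (h :+ h :+ con 1ℤ)) refl h c)

    divide : ∀ x z → ∃ λ y → x ∙ y ≡ z
    divide (cyc A i) (cyc A m) with on? (gap i (m ⊕ ⊖ i))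
    ... | yes (e , g≡0 , s) = fix e , trans (cell-nothing A i s) (cycle-cong (on-symbol i m g≡0))
    ... | no ¬on            = cyc A (m ⊕ ⊖ i) ,
          trans (fill-no (on? (gap i (m ⊕ ⊖ i))) ¬on) (cycle-cong (cancel i m))
    divide (cyc A i) (cyc B m) with off? (gap i (m ⊕ ⊖ i))
    ... | yes (e , s) = fix e , trans (cell-just A i s) (cycle-cong (off-symbol i m))
    ... | no ¬off     = cyc B (m ⊕ ⊖ i) ,
          trans (fill-no (off? (gap i (m ⊕ ⊖ i))) ¬off) (cycle-cong (cancel i m))
    divide (cyc B i) (cyc A m) with off? (gap i (m ⊕ ⊖ i))
    ... | yes (e , s) = fix e , trans (cell-just B i s) (cycle-cong (off-symbol i m))
    -- The symbol has kept its layer A. The extra point cannot occupy the cell either: that would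
    -- need gap 0, which `slot-zero` puts into T.
    ... | no ¬off     = cyc B (m ⊕ ⊖ i) ,
          trans (fill-no (on? g) λ (e , g≡0 , s) →
                   ¬off (subst (λ k → ∃ (OffDiagonal k)) (sym g≡0) (slot-zero (e , s))))
                (cong₂ (λ P k → cyc P k) (layer-no ¬off) (cancel i m))
          where g = gap i (m ⊕ ⊖ i)
    -- A B-symbol stays in the BA-block for gaps outside T. Otherwise it moves to the BB-block,
    -- unless the extra point displaces it from there as well.
    divide (cyc B i) (cyc B m) with off? (⊖ gap i (m ⊕ ⊖ i)) | on? (gap i (m ⊕ ⊖ i))
    ... | no ¬off | _ = cyc A (m ⊕ ⊖ i) ,
          trans (fill-no (off? (⊖ gap i (m ⊕ ⊖ i))) ¬off) (cycle-cong (cancel i m))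
    ... | yes _   | yes (e , g≡0 , s) = fix e ,
          trans (cell-nothing B i s) (cycle-cong (on-symbol i m g≡0))
    ... | yes off | no ¬on = cyc B (m ⊕ ⊖ i) ,
          trans (fill-no (on? (gap i (m ⊕ ⊖ i))) ¬on)
                (cong₂ (λ P k → cyc P k) (layer-yes (off-neg off)) (cancel i m))
    divide (cyc P i) (fix e) with slot e in eq
    divide (cyc A i) (fix e) | just t  = cyc B (i ⊕ h ⊕ t) ,
      fill-yes (off? (gap i (i ⊕ h ⊕ t))) _ off-unique (trans eq (cong just (sym (gap-solve i t))))
    -- The BA-block carries the point of slot t at gap -t.
    divide (cyc B i) (fix e) | just t  = cyc A (i ⊕ h ⊕ ⊖ t) ,
      fill-yes (off? (⊖ gap i (i ⊕ h ⊕ ⊖ t))) _ off-unique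
        (trans eq (cong just (sym (trans (cong ⊖_ (gap-solve i (⊖ t))) (neg-neg t)))))
    divide (cyc A i) (fix e) | nothing = cyc A (i ⊕ h) ,
      fill-yes (on? (gap i (i ⊕ h))) _ on-unique (gap-zero i , eq)
    divide (cyc B i) (fix e) | nothing = cyc B (i ⊕ h) ,
      fill-yes (on? (gap i (i ⊕ h))) _ on-unique (gap-zero i , eq)
    divide (fix e) (cyc P m) with slot e in eq
    -- The column `j` is the solution of 2j - h + t = m, obtained by multiplying with -h, the
    -- inverse of 2.
    ... | just t  = cyc (other P) j , trans (lemma j) (cong₂ (λ Q k → cyc Q k) (other-other P) (begin
          j ⊕ j ⊕ ⊖ h ⊕ t ≡⟨ cong (λ k → k ⊕ ⊖ h ⊕ t) (halve (m ⊕ h ⊕ ⊖ t)) ⟩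
          m ⊕ h ⊕ ⊖ t ⊕ ⊖ h ⊕ t ≡⟨ solve 3 (λ m h t → m :+ h :+ :- t :+ :- h :+ t := m) refl m h t ⟩
          m ∎))
          where
          open ≡-Reasoning
          j = ⊖ h ⊗ (m ⊕ h ⊕ ⊖ t)
          other-other : ∀ P → other (other P) ≡ P
          other-other A = refl
          other-other B = refl
          lemma : ∀ j → fix e ∙ cyc (other P) j ≡ cyc (other (other P)) (j ⊕ j ⊕ ⊖ h ⊕ t)
          lemma j rewrite eq = refl
    ... | nothing = cyc P j , trans (lemma j) (cycle-cong (begin
          j ⊕ j ⊕ ⊖ h ≡⟨ cong (_⊕ ⊖ h) (halve (m ⊕ h)) ⟩
          m ⊕ h ⊕ ⊖ h ≡⟨ solve 2 (λ m h → m :+ h :- h := m) refl m h ⟩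
          m ∎))
          where
          open ≡-Reasoning
          j = ⊖ h ⊗ (m ⊕ h)
          lemma : ∀ j → fix e ∙ cyc P j ≡ cyc P (j ⊕ j ⊕ ⊖ h)
          lemma j rewrite eq = refl
    divide (fix e) (fix e′) = fix (e′ F.⊕ F.⊖ e) , cong (λ k → fix k)
      (F.solve 2 (λ e e′ → e F.:+ (e′ F.:- e) F.:= e′) refl e e′)
      where module F = Cyclic f {{nonZeroIndex e}}

    square : TwistedSquare d f
    square = record { _∙_ = _∙_ ; twisted = twisted ; divide = divide }

module _ (d : ℕ) .{{_ : NonZero d}} (k : ℕ) (2k<d : k + k < d) where

  open Cyclic d

  private

    centred : Fin (suc (k + k)) → Fin d
    centred e = π (+ toℕ e ℤ.- + k)

    -- Adding k back turns e - k into e, which is at most 2k < d and so is its own residue.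
    centred-injective : ∀ {e e′} → centred e ≡ centred e′ → e ≡ e′
    centred-injective {e} {e′} eq = toℕ-injective (begin
      toℕ e                              ≡⟨ uncentre e ⟨
      toℕ (centred e ⊕ π (+ k))          ≡⟨ cong (λ g → toℕ (g ⊕ π (+ k))) eq ⟩
      toℕ (centred e′ ⊕ π (+ k))         ≡⟨ uncentre e′ ⟩
      toℕ e′                             ∎)
      where
      open ≡-Reasoning
      uncentre : ∀ e → toℕ (centred e ⊕ π (+ k)) ≡ toℕ e
      uncentre e = begin
        toℕ (centred e ⊕ π (+ k))        ≡⟨ cong toℕ (π-+ (+ toℕ e ℤ.- + k) (+ k)) ⟨
        toℕ (π (+ toℕ e ℤ.- + k ℤ.+ + k))
          ≡⟨ cong (toℕ ∘ π) (S.solve 2 (λ e k → e S.:- k S.:+ k S.:= e) refl (+ toℕ e) (+ k)) ⟩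
        toℕ (π (+ toℕ e))                ≡⟨ toℕ-π-< (ℕ.<-≤-trans (toℕ<n e) 2k<d) ⟩
        toℕ e                            ∎
        where module S = ℤSolver.+-*-Solver

    -- `opposite` sends e to 2k - e, and (2k - e) - k = -(e - k); this gives the symmetry of T.
    centred-opposite : ∀ e → centred (opposite e) ≡ ⊖ centred e
    centred-opposite e = begin
      π (+ toℕ (opposite e) ℤ.- + k)
        ≡⟨ cong π (S.solve 3 (λ o e k → o S.:- k S.:= (o S.:+ e) S.:- e S.:- k) refl (+ toℕ (opposite e)) (+ toℕ e) (+ k)) ⟩
      π (+ (toℕ (opposite e) + toℕ e) ℤ.- + toℕ e ℤ.- + k) ≡⟨ cong (λ s → π (+ s ℤ.- + toℕ e ℤ.- + k)) sum ⟩
      π (+ (k + k) ℤ.- + toℕ e ℤ.- + k)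
        ≡⟨ cong π (S.solve 2 (λ e k → k S.:+ k S.:- e S.:- k S.:= S.:- (e S.:- k)) refl (+ toℕ e) (+ k)) ⟩
      π (ℤ.- (+ toℕ e ℤ.- + k))                           ≡⟨ π-neg (+ toℕ e ℤ.- + k) ⟩
      ⊖ centred e                                         ∎
      where
      open ≡-Reasoning
      module S = ℤSolver.+-*-Solver
      sum : toℕ (opposite e) + toℕ e ≡ k + k
      sum = trans (cong (_+ toℕ e) (opposite-prop e)) (ℕ.m∸n+n≡m (ℕ.s≤s⁻¹ (toℕ<n e)))

    centred-zero : ∃ λ e → centred e ≡ 𝟘
    centred-zero = fromℕ< k<1+2k , cong π (trans (cong (λ m → + m ℤ.- + k) (toℕ-fromℕ< k<1+2k)) (ℤ.+-inverseʳ (+ k)))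
      where
      k<1+2k : k < suc (k + k)
      k<1+2k = s≤s (ℕ.m≤m+n k k)

  oddSlots : Slots d (suc (k + k))
  oddSlots = record
    { slot           = just ∘ centred
    ; slot-injective = centred-injective ∘ just-injective
    ; slot-symmetric = λ { (e , refl) → opposite e , cong just (centred-opposite e) }
    ; slot-zero      = λ ()
    }

  -- The index `zero` is the extra point; the remaining ones enumerate T, which contains 0 at
  -- position k.
  evenSlots : Slots d (suc (suc (k + k)))
  evenSlots = record
    { slot           = slot
    ; slot-injective = slot-injective _ _
    ; slot-symmetric = λ { (suc e , refl) → suc (opposite e) , cong just (centred-opposite e) }
    ; slot-zero      = λ _ → let e , eq = centred-zero in suc e , cong just eq
    }
    where
    slot : Fin (suc (suc (k + k))) → Maybe (Fin d)
    slot zero    = nothing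
    slot (suc e) = just (centred e)

    slot-injective : ∀ e e′ → slot e ≡ slot e′ → e ≡ e′
    slot-injective zero    zero     _  = refl
    slot-injective (suc e) (suc e′) eq = cong suc (centred-injective (just-injective eq))

-- The action of ℤ/d and the necessary conditions.

turn-turn : ∀ {d f} .{{_ : NonZero d}} g g′ (x : Point d f) →
  let open Cyclic d in turn g (turn g′ x) ≡ turn (g′ ⊕ g) x
turn-turn {d} g g′ (cyc P i) = cong (λ k → cyc P k)
  (solve 3 (λ i g g′ → i :+ g′ :+ g := i :+ (g′ :+ g)) refl i g g′)
  where open Cyclic d
turn-turn g g′ (fix e) = refl

turn-𝟘 : ∀ {d f} .{{_ : NonZero d}} (x : Point d f) → turn (Cyclic.𝟘 d) x ≡ x
turn-𝟘 {d} (cyc P i) = cong (λ k → cyc P k) (solve 1 (λ i → i :+ con 0ℤ := i) refl i)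
  where open Cyclic d
turn-𝟘 (fix e) = refl

double : ∀ q → q + q ≡ 2 * q
double q = cong (q ℕ.+_) (sym (ℕ.+-identityʳ q))

-- For even d this supplies the element of order two used to exclude fixed points.
half-period : ∀ {d} .{{_ : NonZero d}} q → d ≡ q * 2 →
  let open Cyclic d in π (+ q) ⊕ π (+ q) ≡ 𝟘 × π (+ q) ≢ 𝟘
half-period {d} q refl = vanishes , nonzero
  where
  open Cyclic d
  vanishes : π (+ q) ⊕ π (+ q) ≡ 𝟘
  vanishes = begin
    π (+ q) ⊕ π (+ q)  ≡⟨ π-+ (+ q) (+ q) ⟨
    π (+ (q + q))      ≡⟨ cong (λ m → π (+ m)) (trans (double q) (ℕ.*-comm 2 q)) ⟩
    π (+ (q * 2))      ≡⟨ π-period ⟩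
    𝟘                  ∎
    where open ≡-Reasoning
  0<q : 0 < q
  0<q = ℕ.*-cancelʳ-< 2 0 q (ℕ.>-nonZero⁻¹ (q * 2))
  nonzero : π (+ q) ≢ 𝟘
  nonzero eq = ℕ.<⇒≢ 0<q (begin
    0             ≡⟨ toℕ-π-< (ℕ.>-nonZero⁻¹ (q * 2)) ⟨
    toℕ 𝟘         ≡⟨ cong toℕ eq ⟨
    toℕ (π (+ q)) ≡⟨ toℕ-π-< (ℕ.m<m*n q 2 {{ℕ.>-nonZero 0<q}} (s≤s z<s)) ⟩
    q             ∎)
    where open ≡-Reasoning

module _ {d f : ℕ} .{{_ : NonZero d}}
  (_∙_        : Point d f → Point d f → Point d f)
  (twisted    : ∀ x y → rot y ∙ x ≡ rot (x ∙ y))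
  (cancelˡ    : ∀ x {y y′} → x ∙ y ≡ x ∙ y′ → y ≡ y′)
  where

  open Cyclic d

  -- Two applications of the twist give (rot x)(rot y) = rot² (xy); induction on the representative
  -- of g does the rest.
  turn-∙ : ∀ g x y → turn g x ∙ turn g y ≡ turn (g ⊕ g) (x ∙ y)
  turn-∙ g x y = subst (λ g → turn g x ∙ turn g y ≡ turn (g ⊕ g) (x ∙ y)) (π-ι g) (go (toℕ g))
    where
    open ≡-Reasoning
    suc-π : ∀ k → π (+ suc k) ≡ π (+ k) ⊕ 𝟙
    suc-π k = trans (cong (π ∘ +_) (ℕ.+-comm 1 k)) (π-+ (+ k) 1ℤ)
    split : ∀ k (x : Point d f) → turn (π (+ suc k)) x ≡ rot (turn (π (+ k)) x)
    split k x = trans (cong (λ g → turn g x) (suc-π k)) (sym (turn-turn 𝟙 (π (+ k)) x))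
    go : ∀ k → turn (π (+ k)) x ∙ turn (π (+ k)) y ≡ turn (π (+ k) ⊕ π (+ k)) (x ∙ y)
    go zero = begin
      turn 𝟘 x ∙ turn 𝟘 y  ≡⟨ cong₂ _∙_ (turn-𝟘 x) (turn-𝟘 y) ⟩
      x ∙ y                ≡⟨ turn-𝟘 (x ∙ y) ⟨
      turn 𝟘 (x ∙ y)       ≡⟨ cong (λ g → turn g (x ∙ y)) (solve 0 (con 0ℤ := con 0ℤ :+ con 0ℤ) refl) ⟩
      turn (𝟘 ⊕ 𝟘) (x ∙ y) ∎
    go (suc k) = begin
      turn (π (+ suc k)) x ∙ turn (π (+ suc k)) y         ≡⟨ cong₂ _∙_ (split k x) (split k y) ⟩
      rot (turn (π (+ k)) x) ∙ rot (turn (π (+ k)) y)     ≡⟨ twisted (rot (turn (π (+ k)) y)) (turn (π (+ k)) x) ⟩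
      rot (rot (turn (π (+ k)) y) ∙ turn (π (+ k)) x)
        ≡⟨ cong rot (twisted (turn (π (+ k)) x) (turn (π (+ k)) y)) ⟩
      rot (rot (turn (π (+ k)) x ∙ turn (π (+ k)) y))     ≡⟨ cong (rot ∘ rot) (go k) ⟩
      rot (rot (turn (π (+ k) ⊕ π (+ k)) (x ∙ y)))        ≡⟨ cong rot (turn-turn 𝟙 _ (x ∙ y)) ⟩
      rot (turn (π (+ k) ⊕ π (+ k) ⊕ 𝟙) (x ∙ y))          ≡⟨ turn-turn 𝟙 _ (x ∙ y) ⟩
      turn (π (+ k) ⊕ π (+ k) ⊕ 𝟙 ⊕ 𝟙) (x ∙ y)
        ≡⟨ cong (λ g → turn g (x ∙ y))
             (solve 1 (λ a → a :+ a :+ con 1ℤ :+ con 1ℤ := (a :+ con 1ℤ) :+ (a :+ con 1ℤ)) refl (π (+ k))) ⟩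
      turn ((π (+ k) ⊕ 𝟙) ⊕ (π (+ k) ⊕ 𝟙)) (x ∙ y)        ≡⟨ cong (λ g → turn (g ⊕ g) (x ∙ y)) (suc-π k) ⟨
      turn (π (+ suc k) ⊕ π (+ suc k)) (x ∙ y)            ∎

  -- Let g have order two. In a fixed row, turning the column by g turns the symbol by 2g = 0, so
  -- the row would repeat a symbol.
  even⇒no-fixed-points : 2 ∣ d → ¬ Fin f
  even⇒no-fixed-points (divides q d≡q*2) e = g≢0 (begin
    g       ≡⟨ solve 1 (λ g → g := con 0ℤ :+ g) refl g ⟩
    𝟘 ⊕ g   ≡⟨ cong proj₂ (inj₁-injective (cancelˡ (fix e) repeated)) ⟩
    𝟘       ∎)
    where
    open ≡-Reasoning
    g = π (+ q)
    g≢0 = proj₂ (half-period q d≡q*2)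
    y : Point d f
    y = cyc A 𝟘
    repeated : fix e ∙ turn g y ≡ fix e ∙ y
    repeated = begin
      fix e ∙ turn g y           ≡⟨ turn-∙ g (fix e) y ⟩
      turn (g ⊕ g) (fix e ∙ y)   ≡⟨ cong (λ k → turn k (fix e ∙ y)) (proj₁ (half-period q d≡q*2)) ⟩
      turn 𝟘 (fix e ∙ y)         ≡⟨ turn-𝟘 (fix e ∙ y) ⟩
      fix e ∙ y                  ∎

  module _ (cancelʳ : ∀ {x x′} y → x ∙ y ≡ x′ ∙ y → x ≡ x′)
    (divide : ∀ x z → ∃ λ y → x ∙ y ≡ z)
    (1<d : 1 < d) (h : Fin d) (2h+1≡0 : h ⊕ h ⊕ 𝟙 ≡ 𝟘) where

    private

      𝟘≢𝟙 : 𝟘 ≢ 𝟙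
      𝟘≢𝟙 eq with () ← trans (sym (toℕ-π-< (ℕ.<-trans z<s 1<d))) (trans (cong toℕ eq) (toℕ-π-< 1<d))

      origin : Point d f
      origin = cyc A 𝟘

      -- Both j and h are roots of 2x + 1, and j = h + j(2h + 1) - h(2j + 1).
      half-unique : ∀ j → j ≡ ⊖ (j ⊕ 𝟙) → j ≡ h
      half-unique j eq = begin
        j
          ≡⟨ solve 2 (λ j h → j := h :+ j :* (h :+ h :+ con 1ℤ) :- h :* (j :+ (j :+ con 1ℤ))) refl j h ⟩
        h ⊕ j ⊗ (h ⊕ h ⊕ 𝟙) ⊕ ⊖ (h ⊗ (j ⊕ (j ⊕ 𝟙)))
          ≡⟨ cong₂ (λ u v → h ⊕ j ⊗ u ⊕ ⊖ (h ⊗ (v ⊕ (j ⊕ 𝟙)))) 2h+1≡0 eq ⟩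
        h ⊕ j ⊗ 𝟘 ⊕ ⊖ (h ⊗ (⊖ (j ⊕ 𝟙) ⊕ (j ⊕ 𝟙)))
          ≡⟨ solve 2 (λ j h → h :+ j :* con 0ℤ :- h :* (:- (j :+ con 1ℤ) :+ (j :+ con 1ℤ)) := h) refl j h ⟩
        h                                         ∎
        where open ≡-Reasoning

      -- Turning by 1 would preserve the column and the symbol but move row 0_A to row 1_A, so the
      -- column would repeat the symbol.
      not-fixed : ∀ {e e′} → ¬ (origin ∙ fix e′ ≡ fix e)
      not-fixed {e} {e′} eq = 𝟘≢𝟙 (begin
        𝟘      ≡⟨ cong proj₂ (inj₁-injective (cancelʳ (fix e′) moved)) ⟨
        𝟘 ⊕ 𝟙  ≡⟨ solve 0 (con 0ℤ :+ con 1ℤ := con 1ℤ) refl ⟩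
        𝟙      ∎)
        where
        open ≡-Reasoning
        moved : rot origin ∙ fix e′ ≡ origin ∙ fix e′
        moved = begin
          rot origin ∙ rot (fix e′)         ≡⟨ turn-∙ 𝟙 origin (fix e′) ⟩
          turn (𝟙 ⊕ 𝟙) (origin ∙ fix e′)    ≡⟨ cong (turn (𝟙 ⊕ 𝟙)) eq ⟩
          fix e                             ≡⟨ eq ⟨
          origin ∙ fix e′                   ∎

      -- The twist sends cell (0, j) to (j + 1, 0), and turning back by j + 1 gives (0, -j - 1). The
      -- fixed symbol is unchanged and occurs once in the row, so j = -j - 1.
      same-cycle : ∀ {e j} → origin ∙ cyc A j ≡ fix e → j ≡ h
      same-cycle {e} {j} eq = half-unique j (cong proj₂ (inj₁-injective (cancelˡ origin (begin
        origin ∙ cyc A j                           ≡⟨ eq ⟩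
        turn (k ⊕ k) (rot (fix e))                 ≡⟨ cong (turn (k ⊕ k) ∘ rot) eq ⟨
        turn (k ⊕ k) (rot (origin ∙ cyc A j))      ≡⟨ cong (turn (k ⊕ k)) (twisted origin (cyc A j)) ⟨
        turn (k ⊕ k) (rot (cyc A j) ∙ origin)      ≡⟨ turn-∙ k (rot (cyc A j)) origin ⟨
        turn k (rot (cyc A j)) ∙ turn k origin
          ≡⟨ cong₂ (λ u v → cyc A u ∙ cyc A v)
               (solve 1 (λ j → j :+ con 1ℤ :- (j :+ con 1ℤ) := con 0ℤ) refl j)
               (solve 1 (λ k → con 0ℤ :+ k := k) refl k) ⟩
        origin ∙ cyc A k                           ∎))))
        where
        open ≡-Reasoning
        k = ⊖ (j ⊕ 𝟙)

    -- Each fixed symbol is sent to its column in row 0_A. Only the d columns of B and the single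
    -- column h_A can occur.
    odd⇒few-fixed-points : f ≤ suc d
    odd⇒few-fixed-points = injective⇒≤ {f = λ e → code (column e)} λ {e} {e′} eq →
      inj₂-injective (begin
        fix e              ≡⟨ proj₂ (divide origin (fix e)) ⟨
        origin ∙ column e  ≡⟨ cong (origin ∙_) (code-injective e e′ (column-spec e) (column-spec e′) eq) ⟩
        origin ∙ column e′ ≡⟨ proj₂ (divide origin (fix e′)) ⟩
        fix e′             ∎)
      where
      open ≡-Reasoning
      column : Fin f → Point d f
      column e = proj₁ (divide origin (fix e))
      column-spec : ∀ e → origin ∙ column e ≡ fix e
      column-spec e = proj₂ (divide origin (fix e))
      -- The value at a fixed column is junk: in this row no fixed symbol occurs there.
      code : Point d f → Fin (suc d)
      code (cyc B j) = suc j
      code _         = zero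
      code-injective : ∀ {x y} e e′ → origin ∙ x ≡ fix e → origin ∙ y ≡ fix e′ → code x ≡ code y → x ≡ y
      code-injective {cyc A i} {cyc A j} e e′ p q _    = cong (λ k → cyc A k) (trans (same-cycle p) (sym (same-cycle q)))
      code-injective {cyc A i} {cyc B j} e e′ p q ()
      code-injective {cyc B i} {cyc A j} e e′ p q ()
      code-injective {cyc B i} {cyc B j} e e′ p q refl = refl
      code-injective {fix _}             e e′ p q _    = contradiction p not-fixed
      code-injective {cyc A i} {fix _}   e e′ p q _    = contradiction q not-fixed
      code-injective {cyc B i} {fix _}   e e′ p q _    = contradiction q not-fixed

-- Maps of finite sets, and the passage between twisted squares and Latin squares.

-- Pigeonhole: punching out a missed value would inject `Fin (suc n)` into `Fin n`.
injective⇒surjective : ∀ {n} {k : Fin n → Fin n} → (∀ {x y} → k x ≡ k y → x ≡ y) →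
  ∀ y → ∃ λ x → k x ≡ y
injective⇒surjective {suc n} {k} k-injective y with any? (λ x → k x ≟ y)
... | yes hit = hit
... | no miss = contradiction
      (injective⇒≤ {f = λ x → punchOut (missed x)} λ {x} {x′} eq →
        k-injective (punchOut-injective (missed x) (missed x′) eq))
      ℕ.1+n≰n
      where
      missed : ∀ x → y ≢ k x
      missed x eq = miss (x , sym eq)

-- Turns existence of solutions into uniqueness: `k` is injective, hence surjective, so every y has
-- the form `k x`.
rightInverse⇒leftInverse : ∀ {n} (h k : Fin n → Fin n) → (∀ x → h (k x) ≡ x) → ∀ y → k (h y) ≡ y
rightInverse⇒leftInverse h k hk y =
  let x , kx≡y = injective⇒surjective k-injective y
  in subst (λ y → k (h y) ≡ y) kx≡y (cong k (hk x))
  where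
  k-injective : ∀ {x x′} → k x ≡ k x′ → x ≡ x′
  k-injective {x} {x′} eq = trans (sym (hk x)) (trans (cong h eq) (hk x′))

-- A bijection of the points with [n] that conjugates `rot` into β.
record Labelling {n : ℕ} (d f : ℕ) .{{_ : NonZero d}} (β : Permutation′ n) : Set where
  field
    to      : Point d f → Fin n
    from    : Fin n → Point d f
    to-from : ∀ v → to (from v) ≡ v
    from-to : ∀ x → from (to x) ≡ x
    to-rot  : ∀ x → to (rot x) ≡ β ⟨$⟩ʳ to x

  from-rot : ∀ v → from (β ⟨$⟩ʳ v) ≡ rot (from v)
  from-rot v = begin
    from (β ⟨$⟩ʳ v)             ≡⟨ cong (λ v → from (β ⟨$⟩ʳ v)) (to-from v) ⟨
    from (β ⟨$⟩ʳ to (from v))   ≡⟨ cong from (to-rot (from v)) ⟨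
    from (to (rot (from v)))    ≡⟨ from-to (rot (from v)) ⟩
    rot (from v)                ∎
    where open ≡-Reasoning

  to-injective : ∀ {x y} → to x ≡ to y → x ≡ y
  to-injective {x} {y} eq = trans (sym (from-to x)) (trans (cong from eq) (from-to y))

module _ {n d f : ℕ} .{{_ : NonZero d}} {β : Permutation′ n} (labelling : Labelling d f β) where

  open Labelling labelling

  square⇒par : TwistedSquare d f → Par n ⟨ ε , β , β ⨾ ⟨12⟩ ⟩
  square⇒par T = L , autoparatopism
    where
    open ≡-Reasoning
    open TwistedSquare T

    entry : Fin n → Fin n → Fin n
    entry x y = to (from x ∙ from y)

    entry-twisted : ∀ x y → entry (β ⟨$⟩ʳ y) x ≡ β ⟨$⟩ʳ entry x y
    entry-twisted x y = begin
      to (from (β ⟨$⟩ʳ y) ∙ from x)   ≡⟨ cong (λ p → to (p ∙ from x)) (from-rot y) ⟩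
      to (rot (from y) ∙ from x)      ≡⟨ cong to (twisted (from x) (from y)) ⟩
      to (rot (from x ∙ from y))      ≡⟨ to-rot (from x ∙ from y) ⟩
      β ⟨$⟩ʳ entry x y                ∎

    β-injective : ∀ {u v} → β ⟨$⟩ʳ u ≡ β ⟨$⟩ʳ v → u ≡ v
    β-injective eq = trans (sym (inverseˡ β)) (trans (cong (β ⟨$⟩ˡ_) eq) (inverseˡ β))

    solveRow : Fin n → Fin n → Fin n
    solveRow x z = to (proj₁ (divide (from x) (from z)))

    entry-solveRow : ∀ x z → entry x (solveRow x z) ≡ z
    entry-solveRow x z = begin
      to (from x ∙ from (solveRow x z))                 ≡⟨ cong (λ p → to (from x ∙ p)) (from-to _) ⟩
      to (from x ∙ proj₁ (divide (from x) (from z)))    ≡⟨ cong to (proj₂ (divide (from x) (from z))) ⟩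
      to (from z)                                       ≡⟨ to-from z ⟩
      z                                                 ∎

    solveRow-entry : ∀ x y → solveRow x (entry x y) ≡ y
    solveRow-entry x = rightInverse⇒leftInverse (entry x) (solveRow x) (entry-solveRow x)

    solveColumn : Fin n → Fin n → Fin n
    -- The cell (uβ, y) holds L(y, u)β, so u has to solve row y for the symbol zβ⁻¹.
    solveColumn y z = β ⟨$⟩ʳ solveRow y (β ⟨$⟩ˡ z)

    entry-solveColumn : ∀ y z → entry (solveColumn y z) y ≡ z
    entry-solveColumn y z = begin
      entry (solveColumn y z) y                    ≡⟨ entry-twisted y (solveRow y (β ⟨$⟩ˡ z)) ⟩
      β ⟨$⟩ʳ entry y (solveRow y (β ⟨$⟩ˡ z))       ≡⟨ cong (β ⟨$⟩ʳ_) (entry-solveRow y (β ⟨$⟩ˡ z)) ⟩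
      β ⟨$⟩ʳ (β ⟨$⟩ˡ z)                            ≡⟨ inverseʳ β ⟩
      z                                            ∎

    solveColumn-entry : ∀ y x → solveColumn y (entry x y) ≡ x
    solveColumn-entry y =
      rightInverse⇒leftInverse (λ x → entry x y) (solveColumn y) (entry-solveColumn y)

    L : LatinSquare n
    L = record
      { entry       = entry
      ; rowLatin    = λ x z → solveRow x z , entry-solveRow x z , λ { refl → solveRow-entry x _ }
      ; columnLatin = λ y z → solveColumn y z , entry-solveColumn y z , λ { refl → solveColumn-entry y _ }
      }

    autoparatopism : IsAutoparatopism ⟨ ε , β , β ⨾ ⟨12⟩ ⟩ L
    autoparatopism (a , b , c) = mk⇔
      (λ { ((x , y , z) , refl , refl) → entry-twisted x y })
      -- The triple (b, aβ⁻¹, cβ⁻¹) is the preimage of (a, b, c) under the paratopism.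
      (λ { refl → (b , β ⟨$⟩ˡ a , β ⟨$⟩ˡ entry a b) ,
             β-injective (begin
               β ⟨$⟩ʳ entry b (β ⟨$⟩ˡ a)   ≡⟨ entry-twisted b (β ⟨$⟩ˡ a) ⟨
               entry (β ⟨$⟩ʳ (β ⟨$⟩ˡ a)) b ≡⟨ cong (λ a → entry a b) (inverseʳ β) ⟩
               entry a b                   ≡⟨ inverseʳ β ⟨
               β ⟨$⟩ʳ (β ⟨$⟩ˡ entry a b)   ∎) ,
             cong₂ (λ a c → a , b , c) (sym (inverseʳ β)) (sym (inverseʳ β)) })

  module _ (par : Par n ⟨ ε , β , β ⨾ ⟨12⟩ ⟩) where

    open LatinSquare (proj₁ par)
    open ≡-Reasoning

    private

      _∙_ : Point d f → Point d f → Point d f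
      x ∙ y = from (entry (to x) (to y))

      to-∙ : ∀ x y → to (x ∙ y) ≡ entry (to x) (to y)
      to-∙ x y = to-from _

      unique-≡ : ∀ {P : Fin n → Set} {u v} → (∃ λ w → P w × (∀ {w′} → P w′ → w ≡ w′)) → P u → P v → u ≡ v
      unique-≡ (_ , _ , unique) p q = trans (sym (unique p)) (unique q)

      twisted : ∀ x y → rot y ∙ x ≡ rot (x ∙ y)
      twisted x y = begin
        from (entry (to (rot y)) (to x))          ≡⟨ cong (λ v → from (entry v (to x))) (to-rot y) ⟩
        from (entry (β ⟨$⟩ʳ to y) (to x))
          -- The paratopism sends (x, y, L(x, y)) to (yβ, x, L(x, y)β), which must again be a triple
          -- of L.
          ≡⟨ cong from (Equivalence.to (proj₂ par _) ((to x , to y , _) , refl , refl)) ⟩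
        from (β ⟨$⟩ʳ entry (to x) (to y))         ≡⟨ from-rot _ ⟩
        rot (x ∙ y)                               ∎

      cancelˡ : ∀ x {y y′} → x ∙ y ≡ x ∙ y′ → y ≡ y′
      cancelˡ x {y} {y′} eq = to-injective (unique-≡ (rowLatin (to x) (to (x ∙ y)))
        (sym (to-∙ x y)) (trans (sym (to-∙ x y′)) (cong to (sym eq))))

      cancelʳ : ∀ {x x′} y → x ∙ y ≡ x′ ∙ y → x ≡ x′
      cancelʳ {x} {x′} y eq = to-injective (unique-≡ (columnLatin (to y) (to (x ∙ y)))
        (sym (to-∙ x y)) (trans (sym (to-∙ x′ y)) (cong to (sym eq))))

      divide : ∀ x z → ∃ λ y → x ∙ y ≡ z
      divide x z = let v , eq , _ = rowLatin (to x) (to z) in from v , (begin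
        from (entry (to x) (to (from v)))   ≡⟨ cong (λ v → from (entry (to x) v)) (to-from v) ⟩
        from (entry (to x) v)               ≡⟨ cong from eq ⟩
        from (to z)                         ≡⟨ from-to z ⟩
        z                                   ∎)

    par∧even : 2 ∣ d → ¬ Fin f
    par∧even = even⇒no-fixed-points _∙_ twisted cancelˡ

    par∧odd : 1 < d → ∀ h → (let open Cyclic d in h ⊕ h ⊕ 𝟙 ≡ 𝟘) → f ≤ suc d
    par∧odd = odd⇒few-fixed-points _∙_ twisted cancelˡ cancelʳ divide

-- From the cycle structure to a labelling.

iter : {A : Set} → (A → A) → ℕ → A → A
iter g zero    x = x
iter g (suc k) x = iter g k (g x)

module _ {A : Set} (g : A → A) where

  iter-+ : ∀ k l x → iter g (k + l) x ≡ iter g l (iter g k x)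
  iter-+ zero    l x = refl
  iter-+ (suc k) l x = iter-+ k l (g x)

  iter-* : ∀ q {d x} → iter g d x ≡ x → iter g (q * d) x ≡ x
  iter-* zero    _ = refl
  iter-* (suc q) {d} {x} period = begin
    iter g (d + q * d) x          ≡⟨ iter-+ d (q * d) x ⟩
    iter g (q * d) (iter g d x)   ≡⟨ cong (iter g (q * d)) period ⟩
    iter g (q * d) x              ≡⟨ iter-* q period ⟩
    x                             ∎
    where open ≡-Reasoning

  iter-% : ∀ {d x} .{{_ : NonZero d}} → iter g d x ≡ x → ∀ m → iter g (m ℕ.% d) x ≡ iter g m x
  iter-% {d} {x} period m = begin
    iter g (m ℕ.% d) x                          ≡⟨ cong (iter g (m ℕ.% d)) (iter-* (m ℕ./ d) period) ⟨
    iter g (m ℕ.% d) (iter g (m ℕ./ d * d) x)   ≡⟨ iter-+ (m ℕ./ d * d) (m ℕ.% d) x ⟨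
    iter g (m ℕ./ d * d + m ℕ.% d) x
      ≡⟨ cong (λ k → iter g k x) (trans (ℕ.+-comm (m ℕ./ d * d) _) (sym (ℕ.m≡m%n+[m/n]*n m d))) ⟩
    iter g m x                                  ∎
    where open ≡-Reasoning

  -- The end point `y` is kept free so that the induction can drop the head of the list; a cycle is
  -- the case `y` = `x`.
  walk-closes : ∀ x xs {y} → map g (x ∷ xs) ≡ xs ∷ʳ y → iter g (suc (length xs)) x ≡ y
  walk-closes x []        eq = proj₁ (∷-injective eq)
  walk-closes x (x′ ∷ xs) eq with refl , eq′ ← ∷-injective eq = walk-closes x′ xs eq′

  walk-reaches : ∀ x xs {y} → map g (x ∷ xs) ≡ xs ∷ʳ y → ∀ {v} → v ∈ x ∷ xs →
    ∃ λ k → k < suc (length xs) × iter g k x ≡ v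
  walk-reaches x xs        eq (here refl) = 0 , z<s , refl
  walk-reaches x (x′ ∷ xs) eq (there v∈) with refl , eq′ ← ∷-injective eq =
    let k , k<l , reached = walk-reaches x′ xs eq′ v∈ in suc k , s≤s k<l , reached

-- The equation of lengths forces each listed cycle to be a singleton. The last component shows that
-- these points exhaust the listed cycles.
fixed-points : ∀ {n f} (β : Permutation′ n) cs → All (IsCycleOf β) cs →
  replicate f 1 ≡ map List⁺.length cs →
  ∃ λ (p : Fin f → Fin n) → (∀ e → β ⟨$⟩ʳ p e ≡ p e) ×
    (∀ {c v} → c ∈ cs → v ∈ toList c → ∃ λ e → p e ≡ v)
fixed-points {f = zero} β [] _ _ = (λ ()) , (λ ()) , (λ ())
fixed-points {f = suc f} β ((x ∷⁺ []) ∷ cs) (c-cycle ∷ cs-cycles) eq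
  with p , fixed , reaches ← fixed-points {f = f} β cs cs-cycles (proj₂ (∷-injective eq)) =
    (λ { zero → x ; (suc e) → p e }) ,
    (λ { zero → proj₁ (∷-injective c-cycle) ; (suc e) → fixed e }) ,
    λ { (here refl) (here refl) → zero , refl
      ; (there c∈) v∈ → let e , eq′ = reaches c∈ v∈ in suc e , eq′ }

point↔index : ∀ d f → Fin (2 * d + f) ↔ Point d f
point↔index d f = +↔⊎ ∘↔ (*↔× ⊎-↔ ↔-id (Fin f))

-- The point i_A is the i-th iterate of the head of the first d-cycle, and likewise for B. The
-- partition into cycles makes this map surjective, and equal cardinality makes it bijective.
cycleStructure⇒labelling : ∀ {d f} .{{_ : NonZero d}} (β : Permutation′ (2 * d + f)) →
  HasCycleStructure β (replicate 2 d ++ replicate f 1) → Labelling d f β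
cycleStructure⇒labelling {d} {f} β (D , lengths)
  -- The cycles are reordered so that the two d-cycles come first.
  with (a ∷⁺ as) ∷ (b ∷⁺ bs) ∷ rest , eq , perm ← ↭-map-inv List⁺.length lengths
  with a-length , eq₁ ← ∷-injective eq
  with b-length , rest-lengths ← ∷-injective eq₁
  with a-cycle ∷ b-cycle ∷ rest-cycles ← All-resp-↭ perm (CycleDecomposition.areCycles D)
  with p , fixed , reaches ← fixed-points {f = f} β rest rest-cycles rest-lengths = record
  { to      = to
  ; from    = from
  ; to-from = to-from
  ; from-to = from-to
  ; to-rot  = to-rot
  }
  where
  open CycleDecomposition D
  open Cyclic d
  open ≡-Reasoning

  g = β ⟨$⟩ʳ_

  base : Fin 2 → Fin (2 * d + f)
  base A = a
  base B = b

  period : ∀ P → iter g d (base P) ≡ base P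
  period A = trans (cong (λ k → iter g k a) a-length) (walk-closes g a as a-cycle)
  period B = trans (cong (λ k → iter g k b) b-length) (walk-closes g b bs b-cycle)

  to : Point d f → Fin (2 * d + f)
  to (cyc P i) = iter g (toℕ i) (base P)
  to (fix e)   = p e

  to-rot : ∀ x → to (rot x) ≡ g (to x)
  to-rot (cyc P i) = begin
    iter g (toℕ (i ⊕ 𝟙)) (base P)                 ≡⟨ cong (λ k → iter g (toℕ (k ⊕ 𝟙)) (base P)) (π-ι i) ⟨
    iter g (toℕ (π (+ toℕ i) ⊕ 𝟙)) (base P)       ≡⟨ cong (λ k → iter g (toℕ k) (base P)) (π-+ (+ toℕ i) 1ℤ) ⟨
    iter g (toℕ (π (+ (toℕ i + 1)))) (base P)     ≡⟨ cong (λ k → iter g k (base P)) (toℕ-π (toℕ i + 1)) ⟩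
    -- The wrap from d - 1 to 0 is absorbed by the period d of the cycle.
    iter g ((toℕ i + 1) ℕ.% d) (base P)           ≡⟨ iter-% g (period P) (toℕ i + 1) ⟩
    iter g (toℕ i + 1) (base P)                   ≡⟨ iter-+ g (toℕ i) 1 (base P) ⟩
    g (iter g (toℕ i) (base P))                   ∎
  to-rot (fix e) = sym (fixed e)

  cycle-point : ∀ P {v k} → k < d → iter g k (base P) ≡ v → ∃ λ x → to x ≡ v
  cycle-point P {k = k} k<d eq = cyc P (fromℕ< k<d) ,
    trans (cong (λ k → iter g k (base P)) (toℕ-fromℕ< k<d)) eq

  locate : ∀ {c v} → c ∈ (a ∷⁺ as) ∷ (b ∷⁺ bs) ∷ rest → v ∈ toList c → ∃ λ x → to x ≡ v
  locate (here refl) v∈ =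
    let k , k<d , eq = walk-reaches g a as a-cycle v∈ in
    cycle-point A (subst (k <_) (sym a-length) k<d) eq
  locate (there (here refl)) v∈ =
    let k , k<d , eq = walk-reaches g b bs b-cycle v∈ in
    cycle-point B (subst (k <_) (sym b-length) k<d) eq
  locate (there (there c∈)) v∈ = let e , eq = reaches c∈ v∈ in fix e , eq

  preimage : ∀ v → ∃ λ x → to x ≡ v
  preimage v with _ , v∈ , ys∈ ← ∈-concat⁻′ (map toList cycles) (∈-resp-↭ (↭-sym partition) (∈-allFin v))
             with _ , c∈ , refl ← ∈-map⁻ toList ys∈ = locate (∈-resp-↭ perm c∈) v∈

  from : Fin (2 * d + f) → Point d f
  from v = proj₁ (preimage v)

  to-from : ∀ v → to (from v) ≡ v
  to-from v = proj₂ (preimage v)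

  module I = Inverse (point↔index d f)

  -- Through `point↔index` both maps become self-maps of `Fin (2 * d + f)`, where a right inverse is
  -- also a left inverse.
  from-to : ∀ x → from (to x) ≡ x
  from-to x = begin
    from (to x)                              ≡⟨ I.strictlyInverseˡ (from (to x)) ⟨
    I.to (I.from (from (to x)))              ≡⟨ cong (λ x → I.to (I.from (from (to x)))) (I.strictlyInverseˡ x) ⟨
    I.to (I.from (from (to (I.to (I.from x)))))
      ≡⟨ cong I.to (rightInverse⇒leftInverse (to ∘ I.to) (I.from ∘ from)
           (λ v → trans (cong to (I.strictlyInverseˡ (from v))) (to-from v)) (I.from x)) ⟩
    I.to (I.from x)                          ≡⟨ I.strictlyInverseˡ x ⟩
    x                                        ∎

-- The two parities of d.

parity : ∀ m → ∃ λ q → m ≡ q + q ⊎ m ≡ suc (q + q)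
parity zero = 0 , inj₁ refl
parity (suc m) with parity m
... | q , inj₁ refl = q , inj₂ refl
... | q , inj₂ refl = suc q , inj₁ (cong suc (sym (ℕ.+-suc q q)))

-- Provides `h` for d = 2q + 1: it is the residue of q.
half-of-minus-one : ∀ q → let open Cyclic (suc (q + q)) in π (+ q) ⊕ π (+ q) ⊕ 𝟙 ≡ 𝟘
half-of-minus-one q = begin
  π (+ q) ⊕ π (+ q) ⊕ 𝟙    ≡⟨ cong (_⊕ 𝟙) (π-+ (+ q) (+ q)) ⟨
  π (+ (q + q)) ⊕ 𝟙        ≡⟨ π-+ (+ (q + q)) 1ℤ ⟨
  π (+ (q + q + 1))        ≡⟨ cong (π ∘ +_) (ℕ.+-comm (q + q) 1) ⟩
  π (+ suc (q + q))        ≡⟨ π-period ⟩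
  𝟘                        ∎
  where
  open Cyclic (suc (q + q))
  open ≡-Reasoning

double≢odd : ∀ k q → k + k ≢ suc (q + q)
double≢odd k q eq = ℕ.even≢odd k q
  (trans (sym (double k)) (trans eq (cong suc (double q))))

odd-square : ∀ q f → f ≤ suc (suc (q + q)) → TwistedSquare (suc (q + q)) f
odd-square q zero _ = groupSquare (suc (q + q))
odd-square q (suc f) (s≤s f≤) with parity f
-- There are 2k + 1 fixed points; the bound gives 2k ≤ d, strict because d is odd.
... | k , inj₁ refl = Prolongation.square _ _ (half-of-minus-one q) (oddSlots _ k (ℕ.≤∧≢⇒< f≤ (double≢odd k q)))
-- There are 2k + 2 fixed points, the extra one included; the bound 2k + 1 ≤ d already says 2k < d.
... | k , inj₂ refl = Prolongation.square _ _ (half-of-minus-one q) (evenSlots _ k f≤)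

theorem4p14 : (d f n : ℕ) → 1 < d → n ≡ 2 * d + f →
    (β : Permutation′ n) → HasCycleStructure β (replicate 2 d ++ replicate f 1) →
    Par n ⟨ ε , β , β ⨾ ⟨12⟩ ⟩ ⇔ ((2 ∣ d × f ≡ 0) ⊎ (¬ (2 ∣ d) × f ≤ d + 1))
theorem4p14 d f _ 1<d refl β structure with parity d
... | q , inj₁ refl = mk⇔
  (λ par → inj₁ (even , no-points f (par∧even labelling par even)))
  (λ { (inj₁ (_ , refl)) → square⇒par labelling (groupSquare (q + q))
     ; (inj₂ (odd , _))  → contradiction even odd })
  where
  instance
    d≢0 : NonZero (q + q)
    d≢0 = ℕ.>-nonZero (ℕ.<-trans z<s 1<d)
  even : 2 ∣ q + q
  even = divides q (trans (double q) (ℕ.*-comm 2 q))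
  labelling = cycleStructure⇒labelling β structure
  no-points : ∀ f → ¬ Fin f → f ≡ 0
  no-points zero    _    = refl
  no-points (suc _) none = contradiction zero none
... | q , inj₂ refl = mk⇔
  (λ par → inj₂ (odd , subst (f ≤_) (ℕ.+-comm 1 _) (par∧odd labelling par 1<d _ (half-of-minus-one q))))
  (λ { (inj₁ (even , _)) → contradiction even odd
     ; (inj₂ (_ , f≤))   → square⇒par labelling (odd-square q f (subst (f ≤_) (ℕ.+-comm _ 1) f≤)) })
  where
  odd : ¬ (2 ∣ suc (q + q))
  odd (divides k eq) = double≢odd k q (trans (double k) (trans (ℕ.*-comm 2 k) (sym eq)))
  labelling = cycleStructure⇒labelling β structure
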